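{- The type-structure $\mathcal C^{\le}=(\mathcal C^\le_\sigma)_\sigma$, where $\mathcal C^\le_\sigma:=\{x\in\mathcal S_\sigma:\ \mathcal S^\omega_*\models\exists\boldsymbol a\,\forall\boldsymbol b\,\langle\mathcal I_\sigma(x)\rangle^{\boldsymbol a}_{\boldsymbol b}\}$ with $\langle\cdot\rangle$ the canonical-upon-bounding interpretation, is a model of Gödel's theory $\mathsf T$.
   Context: Types: finite types are generated by $\sigma\to\tau$ from the ground types $\mathbb N$, $\mathbb B$ (Booleans); star types allow in addition $\sigma\mapsto\sigma^*$. $\mathcal S^\omega_*$ is the full set-theoretic structure: $\mathcal S_{\mathbb N}=\mathbb N$, $\mathcal S_{\mathbb B}=\{0,1\}$, $\mathcal S_{\rho\to\sigma}$ is the set of all functions from $\mathcal S_\rho$ to $\mathcal S_\sigma$, $\mathcal S_{\sigma^*}$ the set of all non-empty finite subsets of $\mathcal S_\sigma$. Boldface letters are (possibly empty) tuples; $\forall\boldsymbol b\in\boldsymbol B$ means $\forall b_1\in B_1\cdots\forall b_n\in B_n$. For each finite type $\sigma$, tuples of star types $\boldsymbol\tau_\sigma^+,\boldsymbol\tau_\sigma^-$ and the relation $\langle\mathcal I_\sigma(x)\rangle^{\boldsymbol a}_{\boldsymbol b}$ ($x:\sigma$, $\boldsymbol a:\boldsymbol\tau_\sigma^+$, $\boldsymbol b:\boldsymbol\tau_\sigma^-$) are defined by recursion: $\langle\mathcal I_{\mathbb N}(x)\rangle^n$ is $x\le n$ ($\tau^+_{\mathbb N}=\mathbb N$, $\boldsymbol\tau^-_{\mathbb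 N}$ empty); $\langle\mathcal I_{\mathbb B}(i)\rangle$ is true (both tuples empty); and $$\langle\mathcal I_{\rho\to\sigma}(h)\rangle^{\boldsymbol f,\boldsymbol g}_{\boldsymbol a,\boldsymbol d}:\equiv\forall x^\rho(\forall\boldsymbol b\in\boldsymbol g\boldsymbol a\boldsymbol d\,\langle\mathcal I_\rho(x)\rangle^{\boldsymbol a}_{\boldsymbol b}\to\langle\mathcal I_\sigma(hx)\rangle^{\boldsymbol f\boldsymbol a}_{\boldsymbol d}),$$ where $\boldsymbol a:\boldsymbol\tau^+_\rho$, $\boldsymbol d:\boldsymbol\tau^-_\sigma$, $\boldsymbol f$ maps $\boldsymbol\tau_\rho^+$ to $\boldsymbol\tau_\sigma^+$, and $\boldsymbol g$ maps $\boldsymbol\tau_\rho^+,\boldsymbol\tau_\sigma^-$ to tuples of non-empty finite sets of elements of the types $\boldsymbol\tau_\rho^-$. Gödel's $\mathsf T$ is the quantifier-free theory of primitive recursive functionals over the arithmetical types (generated from $\mathbb N$ by $\to$), with constants the combinators $\Pi,\Sigma$, $0$, successor $\mathsf S$ and recursors $\mathsf R_\sigma$ ($\mathsf R0wf=w$, $\mathsf R(\mathsf Sn)wf=fn(\mathsf Rnwf)$). That a family $\mathcal C_\sigma\subseteq\mathcal S_\sigma$ is a model of $\mathsf T$ means: $\mathcal C_{\mathbb N}=\mathbb N$, the family is closed under application and contains the set-theoretic combinators, zero, successor and recursors of arithmetical type, which interpret the constants of $\mathsf T$ (so that the axioms of $\mathsf T$ hold). -}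

module Defs where

open import Data.Bool.Base using (Bool)
open import Data.Empty using (⊥)
open import Data.List.Base using (List; []; _∷_; _++_; map; foldr)
open import Data.List.NonEmpty.Base using (List⁺; toList)
import Data.List.Membership.Setoid as Membership
import Data.List.Relation.Binary.Subset.Setoid as Subset
open import Data.List.Relation.Unary.All using (All; []; _∷_)
open import Data.List.Relation.Unary.All.Properties using (++⁻ˡ; ++⁻ʳ)
open import Data.Nat.Base using (ℕ; zero; suc; _≤_)
open import Data.Product.Base using (_×_; _,_; ∃)
open import Data.Unit.Base using (⊤)
open import Function.Base using (id)
open import Function.Bundles using (Func; _⟨$⟩_)
open import Function.Relation.Binary.Setoid.Equality using (_⇨_)
open import Level using (0ℓ)
open import Relation.Binary.Bundles using (Setoid)
open import Relation.Binary.PropositionalEquality using (_≡_; refl; cong; setoid)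

open Setoid using (Carrier)

data ArithType : Set where
  nat : ArithType
  _⇒_ : ArithType → ArithType → ArithType

data FinType : Set where
  nat bool : FinType
  _⇒_ : FinType → FinType → FinType

data StarType : Set where
  nat bool : StarType
  _⇒_ : StarType → StarType → StarType
  _⋆ : StarType → StarType

infixr 6 _⇒_
infix 8 _⋆

arith : ArithType → FinType
arith nat     = nat
arith (ρ ⇒ σ) = arith ρ ⇒ arith σ

star : FinType → StarType
star nat     = nat
star bool    = bool
star (ρ ⇒ σ) = star ρ ⇒ star σ

-- The non-empty finite subsets of A: non-empty lists, identified when they
-- have the same members (irrespective of order and repetition).

FinSubsets : Setoid 0ℓ 0ℓ → Setoid 0ℓ 0ℓ
FinSubsets A = record
  { Carrier       = List⁺ (Carrier A)
  ; _≈_           = λ xs ys → (toList xs ⊆ toList ys) × (toList ys ⊆ toList xs)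
  ; isEquivalence = record
      { refl  = id , id
      ; sym   = λ (p , q) → q , p
      ; trans = λ (p , q) (p′ , q′) → (λ m → p′ (p m)) , (λ m → q (q′ m))
      }
  }
  where open Subset A using (_⊆_)

-- The full set-theoretic structure.  Sets are rendered as setoids, so the set
-- of all functions is the setoid of all equality-preserving maps, with
-- pointwise equality.

⟦_⟧ : StarType → Setoid 0ℓ 0ℓ
⟦ nat ⟧   = setoid ℕ
⟦ bool ⟧  = setoid Bool
⟦ σ ⇒ τ ⟧ = ⟦ σ ⟧ ⇨ ⟦ τ ⟧
⟦ σ ⋆ ⟧   = FinSubsets ⟦ σ ⟧

⟦_⟧ᶠ : FinType → Setoid 0ℓ 0ℓ
⟦ σ ⟧ᶠ = ⟦ star σ ⟧

⟦_⟧ᵃ : ArithType → Setoid 0ℓ 0ℓ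
⟦ σ ⟧ᵃ = ⟦ arith σ ⟧ᶠ

Elem : FinType → Set
Elem σ = Carrier ⟦ σ ⟧ᶠ

infix 4 _∈⋆_
_∈⋆_ : ∀ {σ} → Carrier ⟦ σ ⟧ → Carrier ⟦ σ ⋆ ⟧ → Set
_∈⋆_ {σ} x B = x ∈ toList B
  where open Membership ⟦ σ ⟧ using (_∈_)

Tuple : List StarType → Set
Tuple = All (λ σ → Carrier ⟦ σ ⟧)

infix 4 _∈ᵗ_
_∈ᵗ_ : ∀ {σs} → Tuple σs → Tuple (map _⋆ σs) → Set
_∈ᵗ_ {[]}     []       []       = ⊤
_∈ᵗ_ {σ ∷ σs} (b ∷ bs) (B ∷ Bs) = _∈⋆_ {σ} b B × bs ∈ᵗ Bs

-- A map from a tuple of types to a tuple of types is a tuple of curried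
-- functionals, each applied to the whole argument tuple.

infixr 6 _⇛_
_⇛_ : List StarType → StarType → StarType
σs ⇛ τ = foldr _⇒_ τ σs

infixl 5 _·_
_·_ : ∀ {σs τ} → Carrier ⟦ σs ⇛ τ ⟧ → Tuple σs → Carrier ⟦ τ ⟧
_·_ {[]}     f []       = f
_·_ {σ ∷ σs} f (x ∷ xs) = _·_ {σs} (f ⟨$⟩ x) xs

infixl 5 _·ᵗ_
_·ᵗ_ : ∀ {σs τs} → Tuple (map (σs ⇛_) τs) → Tuple σs → Tuple τs
_·ᵗ_           {τs = []}     []       xs = []
_·ᵗ_ {σs = σs} {τs = τ ∷ τs} (f ∷ fs) xs = _·_ {σs} f xs ∷ (fs ·ᵗ xs)

mutual
  τ⁺ : FinType → List StarType
  τ⁺ nat     = nat ∷ []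
  τ⁺ bool    = []
  τ⁺ (ρ ⇒ σ) = map (τ⁺ ρ ⇛_) (τ⁺ σ)
            ++ map ((τ⁺ ρ ++ τ⁻ σ) ⇛_) (map _⋆ (τ⁻ ρ))

  τ⁻ : FinType → List StarType
  τ⁻ nat     = []
  τ⁻ bool    = []
  τ⁻ (ρ ⇒ σ) = τ⁺ ρ ++ τ⁻ σ

-- I σ x a b is ⟨I_σ(x)⟩ with upper tuple a and lower tuple b.  At type ρ ⇒ σ
-- the upper tuple is split as f , g and the lower one as a , d.

I : ∀ σ → Elem σ → Tuple (τ⁺ σ) → Tuple (τ⁻ σ) → Set
I nat     x (n ∷ []) [] = x ≤ n
I bool    i []       [] = ⊤
I (ρ ⇒ σ) h fg       ad =
  ∀ (x : Elem ρ) →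
    (∀ (b : Tuple (τ⁻ ρ)) → b ∈ᵗ (g ·ᵗ ad) → I ρ x a b) →
    I σ (h ⟨$⟩ x) (f ·ᵗ a) d
  where
  f : Tuple (map (τ⁺ ρ ⇛_) (τ⁺ σ))
  f = ++⁻ˡ (map (τ⁺ ρ ⇛_) (τ⁺ σ)) fg
  g : Tuple (map ((τ⁺ ρ ++ τ⁻ σ) ⇛_) (map _⋆ (τ⁻ ρ)))
  g = ++⁻ʳ (map (τ⁺ ρ ⇛_) (τ⁺ σ)) fg
  a : Tuple (τ⁺ ρ)
  a = ++⁻ˡ (τ⁺ ρ) ad
  d : Tuple (τ⁻ σ)
  d = ++⁻ʳ (τ⁺ ρ) ad

TypeStructure : Set₁
TypeStructure = ∀ σ → Elem σ → Set

C≤ : TypeStructure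
C≤ σ x = ∃ λ (a : Tuple (τ⁺ σ)) → ∀ (b : Tuple (τ⁻ σ)) → I σ x a b

module _ (A B : Setoid 0ℓ 0ℓ) where
  private
    module A = Setoid A
    module B = Setoid B

  Π-fun : Carrier (A ⇨ B ⇨ A)
  Π-fun = record
    { to   = λ x → record { to = λ _ → x ; cong = λ _ → A.refl }
    ; cong = λ x≈x′ _ → x≈x′
    }

module _ (A B C : Setoid 0ℓ 0ℓ) where
  private
    module C = Setoid C

  Σ-fun : Carrier ((A ⇨ B ⇨ C) ⇨ (A ⇨ B) ⇨ A ⇨ C)
  Σ-fun = record
    { to = λ x → record
      { to = λ y → record
        { to   = λ z → x ⟨$⟩ z ⟨$⟩ (y ⟨$⟩ z)
        ; cong = λ {z} {z′} z≈z′ → C.trans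
            (Func.cong x z≈z′ (y ⟨$⟩ z))
            (Func.cong (x ⟨$⟩ z′) (Func.cong y z≈z′))
        }
      ; cong = λ y≈y′ z → Func.cong (x ⟨$⟩ z) (y≈y′ z)
      }
    ; cong = λ x≈x′ y z → x≈x′ z (y ⟨$⟩ z)
    }

S-fun : Carrier (setoid ℕ ⇨ setoid ℕ)
S-fun = record { to = suc ; cong = cong suc }

module _ (A : Setoid 0ℓ 0ℓ) where
  private
    module A = Setoid A

    Step : Setoid 0ℓ 0ℓ
    Step = setoid ℕ ⇨ A ⇨ A

  iter : ℕ → A.Carrier → Carrier Step → A.Carrier
  iter zero    w f = w
  iter (suc n) w f = f ⟨$⟩ n ⟨$⟩ iter n w f

  private
    iter-cong : ∀ n {w w′ f f′} → w A.≈ w′ → Setoid._≈_ Step f f′ →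
                iter n w f A.≈ iter n w′ f′
    iter-cong zero            w≈w′ f≈f′ = w≈w′
    iter-cong (suc n) {f′ = f′} w≈w′ f≈f′ = A.trans
      (f≈f′ n _)
      (Func.cong (f′ ⟨$⟩ n) (iter-cong n w≈w′ f≈f′))

  R-fun : Carrier (setoid ℕ ⇨ A ⇨ Step ⇨ A)
  R-fun = record
    { to = λ n → record
      { to = λ w → record
        { to   = iter n w
        ; cong = λ {f} {f′} f≈f′ → iter-cong n {f = f} {f′} A.refl f≈f′
        }
      ; cong = λ w≈w′ f → iter-cong n {f = f} {f} w≈w′ (Setoid.refl Step {f})
      }
    ; cong = λ { refl w f → A.refl }
    }

Πᶜ : ∀ (ρ σ : ArithType) → Elem (arith (ρ ⇒ σ ⇒ ρ))
Πᶜ ρ σ = Π-fun ⟦ ρ ⟧ᵃ ⟦ σ ⟧ᵃ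

Σᶜ : ∀ (ρ σ τ : ArithType) →
     Elem (arith ((ρ ⇒ σ ⇒ τ) ⇒ (ρ ⇒ σ) ⇒ ρ ⇒ τ))
Σᶜ ρ σ τ = Σ-fun ⟦ ρ ⟧ᵃ ⟦ σ ⟧ᵃ ⟦ τ ⟧ᵃ

0ᶜ : Elem nat
0ᶜ = zero

Sᶜ : Elem (nat ⇒ nat)
Sᶜ = S-fun

Rᶜ : ∀ (σ : ArithType) → Elem (arith (nat ⇒ σ ⇒ (nat ⇒ σ ⇒ σ) ⇒ σ))
Rᶜ σ = R-fun ⟦ σ ⟧ᵃ

infix 4 Eq
Eq : ∀ σ → Elem σ → Elem σ → Set
Eq σ = Setoid._≈_ ⟦ σ ⟧ᶠ

syntax Eq σ x y = x ≈[ σ ] y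

-- Being a subset of a setoid includes respecting its equality.  Induction is
-- required for arbitrary predicates, hence in particular for quantifier-free formulas with parameters.

record IsModelOfT (C : TypeStructure) : Set₁ where
  field
    resp : ∀ σ {x y : Elem σ} → x ≈[ σ ] y → C σ x → C σ y

    all-ℕ : ∀ (n : Elem nat) → C nat n
    app   : ∀ ρ σ (h : Elem (ρ ⇒ σ)) (x : Elem ρ) →
            C (ρ ⇒ σ) h → C ρ x → C σ (h ⟨$⟩ x)

    Π∈ : ∀ ρ σ → C (arith (ρ ⇒ σ ⇒ ρ)) (Πᶜ ρ σ)
    Σ∈ : ∀ ρ σ τ → C (arith ((ρ ⇒ σ ⇒ τ) ⇒ (ρ ⇒ σ) ⇒ ρ ⇒ τ)) (Σᶜ ρ σ τ)
    0∈ : C nat 0ᶜ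
    S∈ : C (nat ⇒ nat) Sᶜ
    R∈ : ∀ σ → C (arith (nat ⇒ σ ⇒ (nat ⇒ σ ⇒ σ) ⇒ σ)) (Rᶜ σ)

    Π-axiom : ∀ ρ σ x y → C (arith ρ) x → C (arith σ) y →
              Πᶜ ρ σ ⟨$⟩ x ⟨$⟩ y ≈[ arith ρ ] x
    Σ-axiom : ∀ ρ σ τ x y z →
              C (arith (ρ ⇒ σ ⇒ τ)) x → C (arith (ρ ⇒ σ)) y → C (arith ρ) z →
              Σᶜ ρ σ τ ⟨$⟩ x ⟨$⟩ y ⟨$⟩ z ≈[ arith τ ] x ⟨$⟩ z ⟨$⟩ (y ⟨$⟩ z)
    R-zero  : ∀ σ w f → C (arith σ) w → C (arith (nat ⇒ σ ⇒ σ)) f →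
              Rᶜ σ ⟨$⟩ 0ᶜ ⟨$⟩ w ⟨$⟩ f ≈[ arith σ ] w
    R-suc   : ∀ σ n w f →
              C nat n → C (arith σ) w → C (arith (nat ⇒ σ ⇒ σ)) f →
              Rᶜ σ ⟨$⟩ (Sᶜ ⟨$⟩ n) ⟨$⟩ w ⟨$⟩ f
                ≈[ arith σ ] f ⟨$⟩ n ⟨$⟩ (Rᶜ σ ⟨$⟩ n ⟨$⟩ w ⟨$⟩ f)

    S≉0   : ∀ n → C nat n → (Sᶜ ⟨$⟩ n) ≈[ nat ] 0ᶜ → ⊥
    S-inj : ∀ m n → C nat m → C nat n →
            (Sᶜ ⟨$⟩ m) ≈[ nat ] (Sᶜ ⟨$⟩ n) → m ≈[ nat ] n
    induction : ∀ (P : Elem nat → Set) → P 0ᶜ →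
                (∀ n → C nat n → P n → P (Sᶜ ⟨$⟩ n)) →
                ∀ n → C nat n → P n

{-# OPTIONS --safe #-}
module Submission where

-- A point of ρ ⇒ σ is bounded by functionals transforming bounds of arguments
-- into bounds of values, and tests of values into boxes (tuples of non-empty
-- finite sets) of tests of arguments.  Application is then immediate, and the
-- combinators are bounded by functionals built from projections, singletons and
-- unions of boxes.  Upper tuples of the same type have joins, which are monotone
-- for the interpretation; hence h : nat ⇒ σ is in the model as soon as each of its
-- values is.  This reduces the recursor to its values at numerals n, which are
-- combinatory terms by induction on n.

open import Defs

open import Data.Bool.Base using (false)
open import Data.List.Base as List using (List; []; _∷_; _++_; map)
open import Data.List.Membership.Setoid using (find)
open import Data.List.NonEmpty.Base using (List⁺; toList; _⁺++_; _⁺++⁺_; [_])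
  renaming (_∷_ to _∷⁺_)
open import Data.List.Relation.Unary.All using ([]; _∷_)
open import Data.List.Relation.Unary.All.Properties using (++⁺; ++⁻ˡ; ++⁻ʳ)
open import Data.List.Relation.Unary.Any as Any using (here)
open import Data.List.Relation.Unary.Any.Properties
  using (++⁺ˡ; ++⁺ʳ; ++⁻; concatMap⁺; concatMap⁻)
open import Data.Nat.Base using (ℕ; zero; suc; _≤_; z≤n; _⊔_)
open import Data.Nat.Properties
  using (≤-refl; ≤-trans; ≤-pred; m≤n⇒m<n∨m≡n; m≤m⊔n; m≤n⊔m; suc-injective)
open import Data.Product.Base using (_×_; _,_; proj₁; proj₂)
open import Data.Product.Function.NonDependent.Setoid using (proj₁ₛ; proj₂ₛ; <_,_>ₛ)
open import Data.Product.Relation.Binary.Pointwise.NonDependent using (_×ₛ_)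
open import Data.Sum.Base using (inj₁; inj₂; [_,_]′)
open import Data.Unit.Base using (⊤)
open import Function.Base using (_∘_)
open import Function.Bundles using (Func; _⟨$⟩_)
open import Function.Construct.Composition using (function)
import Function.Construct.Constant as Constant
open import Function.Relation.Binary.Setoid.Equality using (_⇨_)
open import Level using (0ℓ)
open import Relation.Binary.Bundles using (Setoid)
open import Relation.Binary.PropositionalEquality
  using (_≡_; refl; sym; trans; cong; cong₂; subst; subst₂; setoid)

open Setoid using (Carrier)

-- Terms in context

-- A term of type A in the context Γ is an equality-preserving map Γ → A, so that
-- composite terms need no separate proof of congruence.

private
  variable
    A B C D Γ : Setoid 0ℓ 0ℓ
    σ τ : StarType
    σs τs : List StarType

infixl 7 _⨾_
_⨾_ : Func A B → Func B C → Func A C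
f ⨾ g = function f g

const : Carrier A → Func Γ A
const {A} {Γ} = Constant.function Γ A

abs : Func (Γ ×ₛ A) B → Func Γ (A ⇨ B)
abs {Γ = Γ} {A = A} f = record
  { to   = λ γ → record
    { to   = λ x → f ⟨$⟩ (γ , x)
    ; cong = λ x≈y → Func.cong f (Setoid.refl Γ , x≈y)
    }
  ; cong = λ γ≈δ x → Func.cong f (γ≈δ , Setoid.refl A)
  }

infixl 8 _∙_
_∙_ : Func Γ (A ⇨ B) → Func Γ A → Func Γ B
_∙_ {B = B} f x = record
  { to   = λ γ → f ⟨$⟩ γ ⟨$⟩ (x ⟨$⟩ γ)
  ; cong = λ {γ} {δ} γ≈δ → Setoid.trans B
      (Func.cong f γ≈δ (x ⟨$⟩ γ))
      (Func.cong (f ⟨$⟩ δ) (Func.cong x γ≈δ))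
  }

post : Func B C → Func (A ⇨ B) (A ⇨ C)
post f = abs (proj₁ₛ ∙ proj₂ₛ ⨾ f)

var₀ : Func (Γ ×ₛ A) A
var₀ = proj₂ₛ

var₁ : Func ((Γ ×ₛ B) ×ₛ A) B
var₁ = proj₁ₛ ⨾ var₀

var₂ : Func (((Γ ×ₛ C) ×ₛ B) ×ₛ A) C
var₂ = proj₁ₛ ⨾ var₁

var₃ : Func ((((Γ ×ₛ D) ×ₛ C) ×ₛ B) ×ₛ A) D
var₃ = proj₁ₛ ⨾ var₂

-- Tuples

-- Inductive rather than by recursion on `σs`, so that a proof determines the tuples it relates and
-- they can stay implicit.
data _≈ᵗ_ : Tuple σs → Tuple σs → Set where
  []  : [] ≈ᵗ []
  _∷_ : {x y : Carrier ⟦ σ ⟧} {xs ys : Tuple σs} →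
        Setoid._≈_ ⟦ σ ⟧ x y → xs ≈ᵗ ys → _≈ᵗ_ {σ ∷ σs} (x ∷ xs) (y ∷ ys)

≈ᵗ-refl : (xs : Tuple σs) → xs ≈ᵗ xs
≈ᵗ-refl []                 = []
≈ᵗ-refl (_∷_ {x = σ} x xs) = Setoid.refl ⟦ σ ⟧ {x} ∷ ≈ᵗ-refl xs

≈ᵗ-sym : {xs ys : Tuple σs} → xs ≈ᵗ ys → ys ≈ᵗ xs
≈ᵗ-sym []                                  = []
≈ᵗ-sym (_∷_ {σ = σ} {x = x} {y} x≈y xs≈ys) =
  Setoid.sym ⟦ σ ⟧ {x} {y} x≈y ∷ ≈ᵗ-sym xs≈ys

≈ᵗ-trans : {xs ys zs : Tuple σs} → xs ≈ᵗ ys → ys ≈ᵗ zs → xs ≈ᵗ zs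
≈ᵗ-trans []             []             = []
≈ᵗ-trans (_∷_ {σ = σ} {x = x} {y} x≈y xs≈ys) (_∷_ {y = z} y≈z ys≈zs) =
  Setoid.trans ⟦ σ ⟧ {x} {y} {z} x≈y y≈z ∷ ≈ᵗ-trans xs≈ys ys≈zs

𝕋 : List StarType → Setoid 0ℓ 0ℓ
𝕋 σs = record
  { Carrier       = Tuple σs
  ; _≈_           = _≈ᵗ_
  ; isEquivalence = record
    { refl  = λ {xs} → ≈ᵗ-refl xs
    ; sym   = ≈ᵗ-sym
    ; trans = ≈ᵗ-trans
    }
  }

headₜ : Func (𝕋 (σ ∷ σs)) ⟦ σ ⟧
headₜ = record { to = λ { (x ∷ _) → x } ; cong = λ { (x≈y ∷ _) → x≈y } }

tailₜ : Func (𝕋 (σ ∷ σs)) (𝕋 σs)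
tailₜ = record { to = λ { (_ ∷ xs) → xs } ; cong = λ { (_ ∷ xs≈ys) → xs≈ys } }

consₜ : Func Γ ⟦ σ ⟧ → Func Γ (𝕋 σs) → Func Γ (𝕋 (σ ∷ σs))
consₜ f fs = record
  { to   = λ γ → (f ⟨$⟩ γ) ∷ (fs ⟨$⟩ γ)
  ; cong = λ γ≈δ → Func.cong f γ≈δ ∷ Func.cong fs γ≈δ
  }

++⁺-cong : {xs xs′ : Tuple σs} {ys ys′ : Tuple τs} →
           xs ≈ᵗ xs′ → ys ≈ᵗ ys′ → ++⁺ xs ys ≈ᵗ ++⁺ xs′ ys′
++⁺-cong []         ys≈ = ys≈
++⁺-cong (x≈ ∷ xs≈) ys≈ = x≈ ∷ ++⁺-cong xs≈ ys≈

++⁻ˡ-cong : ∀ σs {xs ys : Tuple (σs ++ τs)} → xs ≈ᵗ ys → ++⁻ˡ σs xs ≈ᵗ ++⁻ˡ σs ys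
++⁻ˡ-cong []       _          = []
++⁻ˡ-cong (σ ∷ σs) (x≈ ∷ xs≈) = x≈ ∷ ++⁻ˡ-cong σs xs≈

++⁻ʳ-cong : ∀ σs {xs ys : Tuple (σs ++ τs)} → xs ≈ᵗ ys → ++⁻ʳ σs xs ≈ᵗ ++⁻ʳ σs ys
++⁻ʳ-cong []       xs≈       = xs≈
++⁻ʳ-cong (σ ∷ σs) (_ ∷ xs≈) = ++⁻ʳ-cong σs xs≈

leftₜ : ∀ σs → Func (𝕋 (σs ++ τs)) (𝕋 σs)
leftₜ σs = record { to = ++⁻ˡ σs ; cong = ++⁻ˡ-cong σs }

rightₜ : ∀ σs → Func (𝕋 (σs ++ τs)) (𝕋 τs)
rightₜ σs = record { to = ++⁻ʳ σs ; cong = ++⁻ʳ-cong σs }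

uncons : Func (𝕋 (σ ∷ σs) ⇨ A) (⟦ σ ⟧ ⇨ (𝕋 σs ⇨ A))
uncons = abs (abs ((proj₁ₛ ⨾ proj₁ₛ) ∙ consₜ var₁ var₀))

appendₜ : Func Γ (𝕋 σs) → Func Γ (𝕋 τs) → Func Γ (𝕋 (σs ++ τs))
appendₜ f g = record
  { to   = λ γ → ++⁺ (f ⟨$⟩ γ) (g ⟨$⟩ γ)
  ; cong = λ γ≈δ → ++⁺-cong (Func.cong f γ≈δ) (Func.cong g γ≈δ)
  }

++⁻ˡ-++⁺ : (xs : Tuple σs) (ys : Tuple τs) → ++⁻ˡ σs (++⁺ xs ys) ≡ xs
++⁻ˡ-++⁺ []       ys = refl
++⁻ˡ-++⁺ (x ∷ xs) ys = cong (x ∷_) (++⁻ˡ-++⁺ xs ys)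

++⁻ʳ-++⁺ : (xs : Tuple σs) (ys : Tuple τs) → ++⁻ʳ σs (++⁺ xs ys) ≡ ys
++⁻ʳ-++⁺ []       ys = refl
++⁻ʳ-++⁺ (x ∷ xs) ys = ++⁻ʳ-++⁺ xs ys

-- Currying

curryₜ : ∀ σs → Func (𝕋 σs ⇨ ⟦ τ ⟧) ⟦ σs ⇛ τ ⟧
curryₜ []       = record { to = λ f → f ⟨$⟩ [] ; cong = λ f≈g → f≈g [] }
curryₜ (σ ∷ σs) = uncons ⨾ post (curryₜ σs)

-- Propositional equality, finer than that of the setoid, lets bounds be rewritten inside `I` by
-- `subst`, with no congruence of `I` in its tuples.
curryₜ-· : ∀ σs {τ} (f : Func (𝕋 σs) ⟦ τ ⟧) (xs : Tuple σs) →
           _·_ {σs} {τ} (curryₜ σs ⟨$⟩ f) xs ≡ f ⟨$⟩ xs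
curryₜ-· []       f []       = refl
curryₜ-· (σ ∷ σs) f (x ∷ xs) = curryₜ-· σs _ xs

applyₜ : ∀ σs → Func ⟦ σs ⇛ τ ⟧ (𝕋 σs ⇨ ⟦ τ ⟧)
applyₜ {τ} σs = record
  { to   = λ f → record { to = _·_ {σs} {τ} f ; cong = ·-congʳ σs f }
  ; cong = λ {f} {g} → ·-congˡ σs {f} {g}
  }
  where
  ·-congˡ : ∀ σs {f g} → Setoid._≈_ ⟦ σs ⇛ τ ⟧ f g → (xs : Tuple σs) →
            Setoid._≈_ ⟦ τ ⟧ (_·_ {σs} {τ} f xs) (_·_ {σs} {τ} g xs)
  ·-congˡ []       f≈g []       = f≈g
  ·-congˡ (σ ∷ σs) {f} {g} f≈g (x ∷ xs) = ·-congˡ σs {f ⟨$⟩ x} {g ⟨$⟩ x} (f≈g x) xs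

  ·-congʳ : ∀ σs f {xs ys : Tuple σs} → xs ≈ᵗ ys →
            Setoid._≈_ ⟦ τ ⟧ (_·_ {σs} {τ} f xs) (_·_ {σs} {τ} f ys)
  ·-congʳ []       f [] = Setoid.refl ⟦ τ ⟧ {f}
  ·-congʳ (σ ∷ σs) f (_∷_ {x = x} {y} {xs} {ys} x≈y xs≈ys) =
    Setoid.trans ⟦ τ ⟧
      {_·_ {σs} {τ} (f ⟨$⟩ x) xs} {_·_ {σs} {τ} (f ⟨$⟩ y) xs} {_·_ {σs} {τ} (f ⟨$⟩ y) ys}
      (·-congˡ σs {f ⟨$⟩ x} {f ⟨$⟩ y} (Func.cong f x≈y) xs)
      (·-congʳ σs (f ⟨$⟩ y) xs≈ys)

curryᵗ : ∀ σs τs → Func (𝕋 σs ⇨ 𝕋 τs) (𝕋 (map (σs ⇛_) τs))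
curryᵗ σs []       = const []
curryᵗ σs (τ ∷ τs) = consₜ
  (post headₜ ⨾ curryₜ σs)
  (post tailₜ ⨾ curryᵗ σs τs)

curryᵗ-· : ∀ σs τs (f : Func (𝕋 σs) (𝕋 τs)) (xs : Tuple σs) →
           (curryᵗ σs τs ⟨$⟩ f) ·ᵗ xs ≡ f ⟨$⟩ xs
curryᵗ-· σs []       f xs = []-η (f ⟨$⟩ xs)
  where
  []-η : (ys : Tuple []) → [] ≡ ys
  []-η [] = refl
curryᵗ-· σs (τ ∷ τs) f xs = trans
  (cong₂ _∷_ (curryₜ-· σs _ xs) (curryᵗ-· σs τs _ xs))
  (∷-η (f ⟨$⟩ xs))
  where
  ∷-η : (ys : Tuple (τ ∷ τs)) → (headₜ ⟨$⟩ ys) ∷ (tailₜ ⟨$⟩ ys) ≡ ys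
  ∷-η (_ ∷ _) = refl

applyᵗ : ∀ σs τs → Func (𝕋 (map (σs ⇛_) τs)) (𝕋 σs ⇨ 𝕋 τs)
applyᵗ σs []       = abs (const [])
applyᵗ σs (τ ∷ τs) = abs (consₜ
  (((proj₁ₛ ⨾ headₜ) ⨾ applyₜ σs) ∙ var₀)
  (((proj₁ₛ ⨾ tailₜ) ⨾ applyᵗ σs τs) ∙ var₀))

applyᵗ-· : ∀ σs τs (fs : Tuple (map (σs ⇛_) τs)) (xs : Tuple σs) →
           applyᵗ σs τs ⟨$⟩ fs ⟨$⟩ xs ≡ fs ·ᵗ xs
applyᵗ-· σs []       []       xs = refl
applyᵗ-· σs (τ ∷ τs) (f ∷ fs) xs = cong (_·_ {σs} f xs ∷_) (applyᵗ-· σs τs fs xs)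

-- Finite subsets and boxes

inhabitant : ∀ σ → Carrier ⟦ σ ⟧
inhabitant nat     = 0
inhabitant bool    = false
inhabitant (σ ⇒ τ) = const (inhabitant τ)
inhabitant (σ ⋆)   = [ inhabitant σ ]

inhabitants : ∀ σs → Tuple σs
inhabitants []       = []
inhabitants (σ ∷ σs) = inhabitant σ ∷ inhabitants σs

-- Splitting off the head makes the union visibly non-empty, and its underlying list is still, by
-- computation, the `concatMap` over all of the argument.
⋃ : (Carrier A → List⁺ (Carrier B)) → List⁺ (Carrier A) → List⁺ (Carrier B)
⋃ f (x ∷⁺ xs) = f x ⁺++ List.concatMap (toList ∘ f) xs

module _ (A B : Setoid 0ℓ 0ℓ) where
  open import Data.List.Membership.Setoid B using () renaming (_∈_ to _∈ᴮ_)
  open import Data.List.Membership.Setoid A using () renaming (_∈_ to _∈ᴬ_)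

  -- The entry x′ of `X` that witnesses membership of x is only equal to x in the setoid; congruence
  -- of `f` carries y from f x to f x′.
  ∈-⋃⁺ : ∀ (f : Func A (FinSubsets B)) X {x y} →
         x ∈ᴬ toList X → y ∈ᴮ toList (f ⟨$⟩ x) →
         y ∈ᴮ toList (⋃ {A} {B} (f ⟨$⟩_) X)
  ∈-⋃⁺ f X x∈X y∈fx = concatMap⁺ (toList ∘ (f ⟨$⟩_))
    (Any.map (λ x≈x′ → proj₁ (Func.cong f x≈x′) y∈fx) x∈X)

  -- Used in both directions, this shows that `bind` respects equality of sets and of functions.
  ⋃-mono : ∀ (f g : Func A (FinSubsets B)) (X Y : List⁺ (Carrier A)) →
           (∀ {x} → x ∈ᴬ toList X → x ∈ᴬ toList Y) →
           (∀ x {y} → y ∈ᴮ toList (f ⟨$⟩ x) → y ∈ᴮ toList (g ⟨$⟩ x)) →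
           ∀ {y} → y ∈ᴮ toList (⋃ {A} {B} (f ⟨$⟩_) X) →
                   y ∈ᴮ toList (⋃ {A} {B} (g ⟨$⟩_) Y)
  ⋃-mono f g X Y X⊆Y f⊆g y∈ =
    let x , x∈X , y∈fx = find A (concatMap⁻ (toList ∘ (f ⟨$⟩_)) y∈)
    in ∈-⋃⁺ g Y (X⊆Y x∈X) (f⊆g x y∈fx)

bind : Func (FinSubsets A ×ₛ (A ⇨ FinSubsets B)) (FinSubsets B)
bind {A} {B} = record
  { to   = λ (X , f) → ⋃ {A} {B} (f ⟨$⟩_) X
  ; cong = λ { {X , f} {Y , g} ((X⊆Y , Y⊆X) , f≈g) →
        ⋃-mono A B f g X Y X⊆Y (λ x → proj₁ (f≈g x))
      , ⋃-mono A B g f Y X Y⊆X (λ x → proj₂ (f≈g x)) }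
  }

Box : List StarType → Setoid 0ℓ 0ℓ
Box σs = 𝕋 (map _⋆ σs)

-- The union of a family over a box is taken one coordinate at a time. `bindₜ-tail` names the inner
-- union as a function of the first coordinate, for use in `∈-bindₜ`.
bindₜ : ∀ τ σs → Func (Box σs ×ₛ (𝕋 σs ⇨ ⟦ τ ⋆ ⟧)) ⟦ τ ⋆ ⟧
bindₜ-tail : ∀ τ σ σs → Func (Box (σ ∷ σs) ×ₛ (𝕋 (σ ∷ σs) ⇨ ⟦ τ ⋆ ⟧)) (⟦ σ ⟧ ⇨ ⟦ τ ⋆ ⟧)

bindₜ τ []       = proj₂ₛ ∙ const []
bindₜ τ (σ ∷ σs) = < proj₁ₛ ⨾ headₜ , bindₜ-tail τ σ σs >ₛ ⨾ bind {⟦ σ ⟧} {⟦ τ ⟧}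

bindₜ-tail τ σ σs =
  abs (< proj₁ₛ ⨾ proj₁ₛ ⨾ tailₜ , (proj₁ₛ ⨾ proj₂ₛ ⨾ uncons) ∙ var₀ >ₛ ⨾ bindₜ τ σs)

∈-bindₜ : ∀ τ σs (B : Tuple (map _⋆ σs)) (f : Func (𝕋 σs) ⟦ τ ⋆ ⟧) {b c} →
          b ∈ᵗ B → _∈⋆_ {τ} c (f ⟨$⟩ b) → _∈⋆_ {τ} c (bindₜ τ σs ⟨$⟩ (B , f))
∈-bindₜ τ []       []       f {[]}    _           c∈ = c∈
∈-bindₜ τ (σ ∷ σs) (X ∷ B) f {x ∷ b} (x∈X , b∈B) c∈ =
  ∈-⋃⁺ ⟦ σ ⟧ ⟦ τ ⟧ (bindₜ-tail τ σ σs ⟨$⟩ (X ∷ B , f)) X x∈X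
    (∈-bindₜ τ σs B (uncons {A = ⟦ τ ⋆ ⟧} ⟨$⟩ f ⟨$⟩ x) b∈B c∈)

bindᵗ : ∀ σs τs → Func (Box σs ×ₛ (𝕋 σs ⇨ Box τs)) (Box τs)
bindᵗ σs []       = const []
bindᵗ σs (τ ∷ τs) = consₜ
  (< proj₁ₛ , proj₂ₛ ⨾ post headₜ >ₛ ⨾ bindₜ τ σs)
  (< proj₁ₛ , proj₂ₛ ⨾ post tailₜ >ₛ ⨾ bindᵗ σs τs)

-- Coordinatewise unions may give more tuples than the union of the boxes f b. This inclusion
-- suffices: a larger box of tests only strengthens what is assumed of an argument.
∈-bindᵗ : ∀ σs τs (B : Tuple (map _⋆ σs)) (f : Func (𝕋 σs) (Box τs)) {b c} →
          b ∈ᵗ B → c ∈ᵗ (f ⟨$⟩ b) → c ∈ᵗ (bindᵗ σs τs ⟨$⟩ (B , f))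
∈-bindᵗ σs []       B f {c = []}         _   _  = _
∈-bindᵗ σs (τ ∷ τs) B f {b} {c = c ∷ cs} b∈B c∈ =
    ∈-bindₜ τ σs B (post headₜ ⟨$⟩ f) b∈B (proj₁ (uncons-∈ (f ⟨$⟩ b) c∈))
  , ∈-bindᵗ σs τs B (post tailₜ ⟨$⟩ f) b∈B (proj₂ (uncons-∈ (f ⟨$⟩ b) c∈))
  where
  uncons-∈ : (C : Tuple (map _⋆ (τ ∷ τs))) → (c ∷ cs) ∈ᵗ C →
             _∈⋆_ {τ} c (headₜ ⟨$⟩ C) × cs ∈ᵗ (tailₜ ⟨$⟩ C)
  uncons-∈ (_ ∷ _) c∈ = c∈

singleton : Func A (FinSubsets A)
singleton {A} = record
  { to   = [_]
  ; cong = λ x≈y → (λ { (here z≈x) → here (Setoid.trans A z≈x x≈y) })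
                 , (λ { (here z≈y) → here (Setoid.trans A z≈y (Setoid.sym A x≈y)) })
  }

singletonᵗ : ∀ σs → Func (𝕋 σs) (Box σs)
singletonᵗ []       = const []
singletonᵗ (σ ∷ σs) = consₜ (headₜ ⨾ singleton) (tailₜ ⨾ singletonᵗ σs)

∈-singletonᵗ : ∀ σs (b : Tuple σs) → b ∈ᵗ (singletonᵗ σs ⟨$⟩ b)
∈-singletonᵗ []       []      = _
∈-singletonᵗ (σ ∷ σs) (x ∷ b) = here (Setoid.refl ⟦ σ ⟧ {x}) , ∈-singletonᵗ σs b

-- Joins

infix 4 _⊑_ _⊑ᵗ_
-- Functions are compared at one and the same argument, so the functionals themselves need not be
-- monotone.
_⊑_ : ∀ {σ} → Carrier ⟦ σ ⟧ → Carrier ⟦ σ ⟧ → Set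
_⊑_ {nat}   m n = m ≤ n
_⊑_ {bool}  _ _ = ⊤
_⊑_ {σ ⇒ τ} f g = ∀ x → _⊑_ {τ} (f ⟨$⟩ x) (g ⟨$⟩ x)
_⊑_ {σ ⋆}   X Y = ∀ {x} → _∈⋆_ {σ} x X → _∈⋆_ {σ} x Y

data _⊑ᵗ_ : Tuple σs → Tuple σs → Set where
  []  : [] ⊑ᵗ []
  _∷_ : {x y : Carrier ⟦ σ ⟧} {xs ys : Tuple σs} →
        _⊑_ {σ} x y → xs ⊑ᵗ ys → _⊑ᵗ_ {σ ∷ σs} (x ∷ xs) (y ∷ ys)

∈ᵗ-⊑ : ∀ {b : Tuple σs} {B B′} → B ⊑ᵗ B′ → b ∈ᵗ B → b ∈ᵗ B′
∈ᵗ-⊑ {[]}     {[]}    []         _          = _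
∈ᵗ-⊑ {σ ∷ σs} {x ∷ b} (X⊑ ∷ B⊑) (x∈X , b∈B) = X⊑ x∈X , ∈ᵗ-⊑ B⊑ b∈B

++⁻ˡ-⊑ : ∀ σs {xs ys : Tuple (σs ++ τs)} → xs ⊑ᵗ ys → ++⁻ˡ σs xs ⊑ᵗ ++⁻ˡ σs ys
++⁻ˡ-⊑ []       _          = []
++⁻ˡ-⊑ (σ ∷ σs) (x⊑ ∷ xs⊑) = x⊑ ∷ ++⁻ˡ-⊑ σs xs⊑

++⁻ʳ-⊑ : ∀ σs {xs ys : Tuple (σs ++ τs)} → xs ⊑ᵗ ys → ++⁻ʳ σs xs ⊑ᵗ ++⁻ʳ σs ys
++⁻ʳ-⊑ []       xs⊑       = xs⊑
++⁻ʳ-⊑ (σ ∷ σs) (_ ∷ xs⊑) = ++⁻ʳ-⊑ σs xs⊑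

·-⊑ : ∀ σs {τ f g} → _⊑_ {σs ⇛ τ} f g → (xs : Tuple σs) →
      _⊑_ {τ} (_·_ {σs} f xs) (_·_ {σs} g xs)
·-⊑ []       f⊑g []       = f⊑g
·-⊑ (σ ∷ σs) f⊑g (x ∷ xs) = ·-⊑ σs (f⊑g x) xs

·ᵗ-⊑ : ∀ σs τs {fs gs : Tuple (map (σs ⇛_) τs)} → fs ⊑ᵗ gs → (xs : Tuple σs) →
       fs ·ᵗ xs ⊑ᵗ gs ·ᵗ xs
·ᵗ-⊑ σs []       []          xs = []
·ᵗ-⊑ σs (τ ∷ τs) (f⊑ ∷ fs⊑) xs = ·-⊑ σs f⊑ xs ∷ ·ᵗ-⊑ σs τs fs⊑ xs

join : ∀ σ → Func (⟦ σ ⟧ ×ₛ ⟦ σ ⟧) ⟦ σ ⟧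
join nat     = record { to = λ (m , n) → m ⊔ n ; cong = λ (p , q) → cong₂ _⊔_ p q }
-- All Booleans are related by `_⊑_`, so either argument is an upper bound of both.
join bool    = proj₁ₛ
join (σ ⇒ τ) = abs (< (proj₁ₛ ⨾ proj₁ₛ) ∙ var₀ , (proj₁ₛ ⨾ proj₂ₛ) ∙ var₀ >ₛ ⨾ join τ)
join (σ ⋆)   = record
  { to   = λ (X , Y) → X ⁺++⁺ Y
  ; cong = λ { {X , Y} {X′ , Y′} ((X⊆ , X⊇) , (Y⊆ , Y⊇)) →
        ⊆-join X X′ X⊆ Y⊆ , ⊆-join X′ X X⊇ Y⊇ }
  }
  where
  ⊆-join : ∀ X X′ {Y Y′} → _⊑_ {σ ⋆} X X′ → _⊑_ {σ ⋆} Y Y′ →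
           _⊑_ {σ ⋆} (X ⁺++⁺ Y) (X′ ⁺++⁺ Y′)
  ⊆-join X X′ X⊆ Y⊆ z∈ =
    [ ++⁺ˡ ∘ X⊆ , ++⁺ʳ (toList X′) ∘ Y⊆ ]′ (++⁻ (toList X) z∈)

⊑-joinˡ : ∀ σ x y → _⊑_ {σ} x (join σ ⟨$⟩ (x , y))
⊑-joinˡ nat     m n = m≤m⊔n m n
⊑-joinˡ bool    _ _ = _
⊑-joinˡ (σ ⇒ τ) f g = λ x → ⊑-joinˡ τ (f ⟨$⟩ x) (g ⟨$⟩ x)
⊑-joinˡ (σ ⋆)   X Y = ++⁺ˡ

⊑-joinʳ : ∀ σ x y → _⊑_ {σ} y (join σ ⟨$⟩ (x , y))
⊑-joinʳ nat     m n = m≤n⊔m m n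
⊑-joinʳ bool    _ _ = _
⊑-joinʳ (σ ⇒ τ) f g = λ x → ⊑-joinʳ τ (f ⟨$⟩ x) (g ⟨$⟩ x)
⊑-joinʳ (σ ⋆)   X Y = ++⁺ʳ (toList X)

joinᵗ : ∀ σs → Func (𝕋 σs ×ₛ 𝕋 σs) (𝕋 σs)
joinᵗ []       = const []
joinᵗ (σ ∷ σs) = consₜ
  (< proj₁ₛ ⨾ headₜ , proj₂ₛ ⨾ headₜ >ₛ ⨾ join σ)
  (< proj₁ₛ ⨾ tailₜ , proj₂ₛ ⨾ tailₜ >ₛ ⨾ joinᵗ σs)

⊑-joinᵗˡ : ∀ σs xs ys → xs ⊑ᵗ (joinᵗ σs ⟨$⟩ (xs , ys))
⊑-joinᵗˡ []       []       []       = []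
⊑-joinᵗˡ (σ ∷ σs) (x ∷ xs) (y ∷ ys) = ⊑-joinˡ σ x y ∷ ⊑-joinᵗˡ σs xs ys

⊑-joinᵗʳ : ∀ σs xs ys → ys ⊑ᵗ (joinᵗ σs ⟨$⟩ (xs , ys))
⊑-joinᵗʳ []       []       []       = []
⊑-joinᵗʳ (σ ∷ σs) (x ∷ xs) (y ∷ ys) = ⊑-joinʳ σ x y ∷ ⊑-joinᵗʳ σs xs ys

-- The interpretation

⁺ ⁻ : FinType → Setoid 0ℓ 0ℓ
⁺ σ = 𝕋 (τ⁺ σ)
⁻ σ = 𝕋 (τ⁻ σ)

I-resp : ∀ σ {x y : Elem σ} {a b} → x ≈[ σ ] y → I σ x a b → I σ y a b
I-resp nat     refl i = i
I-resp bool    {a = []} {[]} _ _ = _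
I-resp (ρ ⇒ σ) h≈k i x hx = I-resp σ (h≈k x) (i x hx)

-- At an arrow type a larger f weakens the conclusion, by induction, and a larger g enlarges the box
-- of tests, which strengthens the premise.
I-mono : ∀ σ {x : Elem σ} {a a′ b} → a ⊑ᵗ a′ → I σ x a b → I σ x a′ b
I-mono nat  {b = []} (m≤n ∷ []) x≤m = ≤-trans x≤m m≤n
I-mono bool {b = []} []         _   = _
I-mono (ρ ⇒ σ) {b = ad} fg⊑ i x hx =
  I-mono σ (·ᵗ-⊑ (τ⁺ ρ) (τ⁺ σ) (++⁻ˡ-⊑ (map (τ⁺ ρ ⇛_) (τ⁺ σ)) fg⊑) (++⁻ˡ (τ⁺ ρ) ad))
    (i x λ b b∈ → hx b (∈ᵗ-⊑
      (·ᵗ-⊑ (τ⁺ ρ ++ τ⁻ σ) (map _⋆ (τ⁻ ρ)) (++⁻ʳ-⊑ (map (τ⁺ ρ ⇛_) (τ⁺ σ)) fg⊑) ad) b∈))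

module _ (ρ σ : FinType) where

  bound : Func Γ (⁺ (ρ ⇒ σ)) → Func Γ (⁺ ρ) → Func Γ (⁺ σ)
  bound fg a = (fg ⨾ leftₜ (map (τ⁺ ρ ⇛_) (τ⁺ σ)) ⨾ applyᵗ (τ⁺ ρ) (τ⁺ σ)) ∙ a

  test : Func Γ (⁺ (ρ ⇒ σ)) → Func Γ (⁺ ρ) → Func Γ (⁻ σ) → Func Γ (Box (τ⁻ ρ))
  test fg a d =
    (fg ⨾ rightₜ (map (τ⁺ ρ ⇛_) (τ⁺ σ)) ⨾ applyᵗ (τ⁻ (ρ ⇒ σ)) (map _⋆ (τ⁻ ρ)))
      ∙ appendₜ a d

  realizer : Func (Γ ×ₛ ⁺ ρ) (⁺ σ) → Func ((Γ ×ₛ ⁺ ρ) ×ₛ ⁻ σ) (Box (τ⁻ ρ)) →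
             Func Γ (⁺ (ρ ⇒ σ))
  realizer f g = appendₜ
    (abs f ⨾ curryᵗ (τ⁺ ρ) (τ⁺ σ))
    (abs (< < proj₁ₛ , proj₂ₛ ⨾ leftₜ (τ⁺ ρ) >ₛ , proj₂ₛ ⨾ rightₜ (τ⁺ ρ) >ₛ ⨾ g)
      ⨾ curryᵗ (τ⁻ (ρ ⇒ σ)) (map _⋆ (τ⁻ ρ)))

  -- Introduction rule for bounds at arrow types: splitting and applying the curried, appended tuple
  -- gives back f and g.
  I-realizer : ∀ {Γ} (f : Func (Γ ×ₛ ⁺ ρ) (⁺ σ)) g γ ad (h : Elem (ρ ⇒ σ)) →
    let a = ++⁻ˡ (τ⁺ ρ) ad
        d = ++⁻ʳ (τ⁺ ρ) ad
    in (∀ x → (∀ b → b ∈ᵗ (g ⟨$⟩ ((γ , a) , d)) → I ρ x a b) →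
              I σ (h ⟨$⟩ x) (f ⟨$⟩ (γ , a)) d) →
       I (ρ ⇒ σ) h (realizer f g ⟨$⟩ γ) ad
  I-realizer {Γ} f g γ ad h i x hx =
    subst (λ t → I σ (h ⟨$⟩ x) t d) (sym f-eq)
      (i x λ b b∈ → hx b (subst (b ∈ᵗ_) (sym g-eq) b∈))
    where
    a = ++⁻ˡ (τ⁺ ρ) ad
    d = ++⁻ʳ (τ⁺ ρ) ad

    f-eq : ++⁻ˡ (map (τ⁺ ρ ⇛_) (τ⁺ σ)) (realizer f g ⟨$⟩ γ) ·ᵗ a ≡ f ⟨$⟩ (γ , a)
    f-eq = trans (cong (_·ᵗ a) (++⁻ˡ-++⁺ _ _)) (curryᵗ-· (τ⁺ ρ) (τ⁺ σ) _ a)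

    g-eq : ++⁻ʳ (map (τ⁺ ρ ⇛_) (τ⁺ σ)) (realizer f g ⟨$⟩ γ) ·ᵗ ad ≡ g ⟨$⟩ ((γ , a) , d)
    g-eq = trans (cong (_·ᵗ ad) (++⁻ʳ-++⁺ {σs = map (τ⁺ ρ ⇛_) (τ⁺ σ)} _ _))
                 (curryᵗ-· (τ⁻ (ρ ⇒ σ)) (map _⋆ (τ⁻ ρ)) _ ad)

  -- Elimination rule, the counterpart of `I-realizer`; being stated for terms in context, it can be
  -- nested along an applicative expression.
  I-apply : ∀ {Γ} (fg : Func Γ (⁺ (ρ ⇒ σ))) a d γ (h : Elem (ρ ⇒ σ)) x →
    I (ρ ⇒ σ) h (fg ⟨$⟩ γ) (appendₜ a d ⟨$⟩ γ) →
    (∀ b → b ∈ᵗ (test fg a d ⟨$⟩ γ) → I ρ x (a ⟨$⟩ γ) b) →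
    I σ (h ⟨$⟩ x) (bound fg a ⟨$⟩ γ) (d ⟨$⟩ γ)
  I-apply fg a d γ h x i hx =
    subst (λ t → I σ (h ⟨$⟩ x) t d′) (sym (applyᵗ-· (τ⁺ ρ) (τ⁺ σ) f a′))
      (subst₂ (λ s t → I σ (h ⟨$⟩ x) (f ·ᵗ s) t) (++⁻ˡ-++⁺ a′ d′) (++⁻ʳ-++⁺ a′ d′)
        (i x λ b b∈ → subst (λ s → I ρ x s b) (sym (++⁻ˡ-++⁺ a′ d′))
          (hx b (subst (b ∈ᵗ_) (sym (applyᵗ-· (τ⁻ (ρ ⇒ σ)) (map _⋆ (τ⁻ ρ)) g _)) b∈))))
    where
    a′ = a ⟨$⟩ γ
    d′ = d ⟨$⟩ γ
    f = ++⁻ˡ (map (τ⁺ ρ ⇛_) (τ⁺ σ)) (fg ⟨$⟩ γ)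
    g = ++⁻ʳ (map (τ⁺ ρ ⇛_) (τ⁺ σ)) (fg ⟨$⟩ γ)

-- Closure properties of the model

C≤-resp : ∀ σ {x y : Elem σ} → x ≈[ σ ] y → C≤ σ x → C≤ σ y
C≤-resp σ x≈y (a , i) = a , λ b → I-resp σ x≈y (i b)

C≤-app : ∀ ρ σ {h : Elem (ρ ⇒ σ)} {x : Elem ρ} →
         C≤ (ρ ⇒ σ) h → C≤ ρ x → C≤ σ (h ⟨$⟩ x)
C≤-app ρ σ {h} {x} (fg , i) (a , j) = _ , λ d →
  -- The bound `a` of x is good for every test, in particular for those in the box that `fg` asks
  -- for.
  I-apply ρ σ {setoid ⊤} (const fg) (const a) (const d) _ h x (i _) (λ b _ → j b)

-- The bound for the argument is only an upper bound n, so the values at all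
-- x ≤ n have to be bounded at once, which the join of their bounds does.
C≤-nat⇒ : ∀ σ {h : Elem (nat ⇒ σ)} → (∀ n → C≤ σ (h ⟨$⟩ n)) → C≤ (nat ⇒ σ) h
C≤-nat⇒ σ {h} c = realizer nat σ (proj₂ₛ {A = setoid ⊤} ⨾ joins) (const []) ⟨$⟩ _ , λ ad →
  I-realizer nat σ (proj₂ₛ {A = setoid ⊤} ⨾ joins) (const []) _ ad h λ x hx →
  -- Numbers have only the empty test tuple, and the premise at it says that x is at most the given
  -- bound.
  joins-bound (++⁻ˡ (τ⁺ nat) ad) x (hx [] _)
  where
  sup : ℕ → Tuple (τ⁺ σ)
  sup zero    = proj₁ (c zero)
  sup (suc n) = joinᵗ (τ⁺ σ) ⟨$⟩ (sup n , proj₁ (c (suc n)))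

  sup-bound : ∀ {x n} d → x ≤ n → I σ (h ⟨$⟩ x) (sup n) d
  sup-bound {n = zero}  d z≤n = proj₂ (c zero) d
  sup-bound {n = suc n} d x≤1+n with m≤n⇒m<n∨m≡n x≤1+n
  ... | inj₁ x<1+n = I-mono σ (⊑-joinᵗˡ _ _ _) (sup-bound d (≤-pred x<1+n))
  ... | inj₂ refl  = I-mono σ (⊑-joinᵗʳ _ _ _) (proj₂ (c (suc n)) d)

  joins : Func (⁺ nat) (⁺ σ)
  joins = record { to = λ { (n ∷ []) → sup n } ; cong = λ { (refl ∷ []) → ≈ᵗ-refl _ } }

  joins-bound : ∀ a x {d} → I nat x a [] → I σ (h ⟨$⟩ x) (joins ⟨$⟩ a) d
  joins-bound (n ∷ []) x x≤n = sup-bound _ x≤n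

-- The value is x itself: its bound is returned unchanged, and a test of the value becomes the
-- singleton box of tests of x.
C≤-Π : ∀ ρ σ → C≤ (ρ ⇒ σ ⇒ ρ) (Π-fun ⟦ ρ ⟧ᶠ ⟦ σ ⟧ᶠ)
C≤-Π ρ σ = realizer ρ (σ ⇒ ρ) Wₓ test-x ⟨$⟩ _ , λ b →
  let xᵇ = ++⁻ˡ (τ⁺ ρ) b
      b′ = ++⁻ʳ (τ⁺ ρ) b
      K  = Π-fun ⟦ ρ ⟧ᶠ ⟦ σ ⟧ᶠ
  in
  I-realizer ρ (σ ⇒ ρ) Wₓ test-x _ b K λ x hx →
  I-realizer σ ρ value test-y (_ , xᵇ) b′ (K ⟨$⟩ x) λ y _ →
  hx _ (∈-singletonᵗ (τ⁻ ρ) _)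
  where
  value : Func ((setoid ⊤ ×ₛ ⁺ ρ) ×ₛ ⁺ σ) (⁺ ρ)
  value = var₁

  -- The second argument is irrelevant, but a box cannot be empty.
  test-y : Func (((setoid ⊤ ×ₛ ⁺ ρ) ×ₛ ⁺ σ) ×ₛ ⁻ ρ) (Box (τ⁻ σ))
  test-y = const (inhabitants (map _⋆ (τ⁻ σ)))

  Wₓ : Func (setoid ⊤ ×ₛ ⁺ ρ) (⁺ (σ ⇒ ρ))
  Wₓ = realizer σ ρ value test-y

  test-x : Func ((setoid ⊤ ×ₛ ⁺ ρ) ×ₛ ⁻ (σ ⇒ ρ)) (Box (τ⁻ ρ))
  test-x = var₀ ⨾ rightₜ (τ⁺ σ) ⨾ singletonᵗ (τ⁻ ρ)

-- To test x z (y z) at d, test x at (a , y a , d) and y at (a , e) for every e at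
-- which x then requires y z to be tested; z is tested wherever x or y requires.
C≤-Σ : ∀ ρ σ τ → C≤ ((ρ ⇒ σ ⇒ τ) ⇒ (ρ ⇒ σ) ⇒ ρ ⇒ τ) (Σ-fun ⟦ ρ ⟧ᶠ ⟦ σ ⟧ᶠ ⟦ τ ⟧ᶠ)
C≤-Σ ρ σ τ = W ⟨$⟩ _ , λ b →
  let xᵇ = ++⁻ˡ (τ⁺ X) b
      b′ = ++⁻ʳ (τ⁺ X) b
      yᵇ = ++⁻ˡ (τ⁺ Y) b′
      ad = ++⁻ʳ (τ⁺ Y) b′
      a  = ++⁻ˡ (τ⁺ ρ) ad
      d  = ++⁻ʳ (τ⁺ ρ) ad
      γ₂ = (_ , xᵇ) , yᵇ
      γ₄ = (γ₂ , a) , d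
      S  = Σ-fun ⟦ ρ ⟧ᶠ ⟦ σ ⟧ᶠ ⟦ τ ⟧ᶠ
  in
  I-realizer X (Y ⇒ ρ ⇒ τ) Wₓ test-x _ b S λ x hx →
  I-realizer Y (ρ ⇒ τ) W_y test-y (_ , xᵇ) b′ (S ⟨$⟩ x) λ y hy →
  I-realizer ρ τ (value var₂ var₁ var₀) test-z γ₂ ad (S ⟨$⟩ x ⟨$⟩ y) λ z hz →
  I-apply σ τ {Γ₄} (bound ρ (σ ⇒ τ) var₃ var₁) (bound ρ σ var₂ var₁) var₀ γ₄ (x ⟨$⟩ z) (y ⟨$⟩ z)
    -- `test-x` contains exactly the test (a , y a , d) at which x is applied here; the left part of
    -- `test-z` holds what x then asks of z.
    (I-apply ρ (σ ⇒ τ) {Γ₄} var₃ var₁ (challenge-x var₃ var₂ var₁ var₀) γ₄ x z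
      (hx _ (∈-singletonᵗ (τ⁻ X) _))
      (λ c c∈ → hz c (∈ᵗ-⊑ (⊑-joinᵗˡ (map _⋆ (τ⁻ ρ)) _ _) c∈)))
    -- For each test e of y z demanded by x z, the union `test-y` contains (a , e), and the right
    -- part of `test-z` contains what y asks of z at e.
    (λ e e∈ → I-apply ρ σ {Γ₄} var₂ var₁ (const e) γ₄ y z
      (hy (++⁺ a e) (∈-bindᵗ (τ⁻ σ) (τ⁻ Y) _ _ e∈ (∈-singletonᵗ (τ⁻ Y) _)))
      (λ c c∈ → hz c (∈ᵗ-⊑ (⊑-joinᵗʳ (map _⋆ (τ⁻ ρ)) _ _)
        (∈-bindᵗ (τ⁻ σ) (τ⁻ ρ) _ _ e∈ c∈))))
  where
  X Y : FinType
  X = ρ ⇒ σ ⇒ τ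
  Y = ρ ⇒ σ

  module _ (x : Func Γ (⁺ X)) (y : Func Γ (⁺ Y)) (a : Func Γ (⁺ ρ)) where

    value : Func Γ (⁺ τ)
    value = bound σ τ (bound ρ (σ ⇒ τ) x a) (bound ρ σ y a)

    module _ (d : Func Γ (⁻ τ)) where

      challenge-x : Func Γ (⁻ (σ ⇒ τ))
      challenge-x = appendₜ (bound ρ σ y a) d

      challenges-yz : Func Γ (Box (τ⁻ σ))
      challenges-yz = test σ τ (bound ρ (σ ⇒ τ) x a) (bound ρ σ y a) d

  Γ₄ : Setoid 0ℓ 0ℓ
  Γ₄ = (((setoid ⊤ ×ₛ ⁺ X) ×ₛ ⁺ Y) ×ₛ ⁺ ρ) ×ₛ ⁻ τ

  test-z : Func Γ₄ (Box (τ⁻ ρ))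
  test-z = < test ρ (σ ⇒ τ) var₃ var₁ (challenge-x var₃ var₂ var₁ var₀)
           , < challenges-yz var₃ var₂ var₁ var₀
             , abs (test ρ σ (proj₁ₛ ⨾ var₂) (proj₁ₛ ⨾ var₁) var₀) >ₛ
             ⨾ bindᵗ (τ⁻ σ) (τ⁻ ρ) >ₛ
           ⨾ joinᵗ (map _⋆ (τ⁻ ρ))

  W_y : Func ((setoid ⊤ ×ₛ ⁺ X) ×ₛ ⁺ Y) (⁺ (ρ ⇒ τ))
  W_y = realizer ρ τ (value var₂ var₁ var₀) test-z

  test-y : Func (((setoid ⊤ ×ₛ ⁺ X) ×ₛ ⁺ Y) ×ₛ ⁻ (ρ ⇒ τ)) (Box (τ⁻ Y))
  test-y =
    < challenges-yz var₂ var₁ a d , abs (appendₜ (proj₁ₛ ⨾ a) var₀ ⨾ singletonᵗ (τ⁻ Y)) >ₛ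
    ⨾ bindᵗ (τ⁻ σ) (τ⁻ Y)
    where
    a = var₀ ⨾ leftₜ (τ⁺ ρ)
    d = var₀ ⨾ rightₜ (τ⁺ ρ)

  Wₓ : Func (setoid ⊤ ×ₛ ⁺ X) (⁺ (Y ⇒ ρ ⇒ τ))
  Wₓ = realizer Y (ρ ⇒ τ) W_y test-y

  test-x : Func ((setoid ⊤ ×ₛ ⁺ X) ×ₛ ⁻ (Y ⇒ ρ ⇒ τ)) (Box (τ⁻ X))
  test-x = appendₜ a (challenge-x var₁ y a d) ⨾ singletonᵗ (τ⁻ X)
    where
    y  = var₀ ⨾ leftₜ (τ⁺ Y)
    ad = var₀ ⨾ rightₜ (τ⁺ Y)
    a  = ad ⨾ leftₜ (τ⁺ ρ)
    d  = ad ⨾ rightₜ (τ⁺ ρ)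

  W : Func (setoid ⊤) (⁺ (X ⇒ Y ⇒ ρ ⇒ τ))
  W = realizer X (Y ⇒ ρ ⇒ τ) Wₓ test-x

-- Combinatory terms and the recursor

record Point (σ : FinType) : Set where
  constructor point
  field
    element : Elem σ
    member  : C≤ σ element

open Point

private
  variable
    υ φ χ : FinType

infixl 5 _◂_
-- Combinatory terms written with `_◂_`, `K` and `S` carry their own proof of membership.
_◂_ : Point (υ ⇒ φ) → Point υ → Point φ
_◂_ {υ} {φ} (point h c) (point x d) = point (h ⟨$⟩ x) (C≤-app υ φ {h} {x} c d)

K : Point (υ ⇒ φ ⇒ υ)
K {υ} {φ} = point (Π-fun ⟦ υ ⟧ᶠ ⟦ φ ⟧ᶠ) (C≤-Π υ φ)

S : Point ((υ ⇒ φ ⇒ χ) ⇒ (υ ⇒ φ) ⇒ υ ⇒ χ)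
S {υ} {φ} {χ} = point (Σ-fun ⟦ υ ⟧ᶠ ⟦ φ ⟧ᶠ ⟦ χ ⟧ᶠ) (C≤-Σ υ φ χ)

-- `S ◂ K ◂ K` is the identity, so at f the term computes to f applied to x.
eval-at : Point υ → Point ((υ ⇒ φ) ⇒ φ)
eval-at {υ} {φ} x = S ◂ (S ◂ K ◂ K {φ = υ}) ◂ (K ◂ x)

C≤-nat : ∀ n → C≤ nat n
C≤-nat n = n ∷ [] , λ { [] → ≤-refl }

-- R (n + 1) = S (K (S T)) (R n), where T f = f n.
recursor : ∀ σ → ℕ → Point (σ ⇒ (nat ⇒ σ ⇒ σ) ⇒ σ)
recursor σ zero    = K
recursor σ (suc n) = S ◂ (K ◂ (S ◂ eval-at (point n (C≤-nat n)))) ◂ recursor σ n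

-- Both sides compute to w at zero; at a successor both compute to f n applied to their values at n,
-- which agree by induction.
recursor-≈ : ∀ σ n → element (recursor σ n) ≈[ σ ⇒ (nat ⇒ σ ⇒ σ) ⇒ σ ] (R-fun ⟦ σ ⟧ᶠ ⟨$⟩ n)
recursor-≈ σ zero    w f = Setoid.refl ⟦ σ ⟧ᶠ
recursor-≈ σ (suc n) w f = Func.cong (f ⟨$⟩ n) (recursor-≈ σ n w f)

C≤-R : ∀ σ → C≤ (nat ⇒ σ ⇒ (nat ⇒ σ ⇒ σ) ⇒ σ) (R-fun ⟦ σ ⟧ᶠ)
C≤-R σ = C≤-nat⇒ (σ ⇒ (nat ⇒ σ ⇒ σ) ⇒ σ) {R-fun ⟦ σ ⟧ᶠ} λ n →
  C≤-resp (σ ⇒ (nat ⇒ σ ⇒ σ) ⇒ σ) {element (recursor σ n)} {R-fun ⟦ σ ⟧ᶠ ⟨$⟩ n} (recursor-≈ σ n)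
    (member (recursor σ n))

theorem8p23 : IsModelOfT C≤
theorem8p23 = record
  { resp      = C≤-resp
  ; all-ℕ     = C≤-nat
  ; app       = λ ρ σ h x → C≤-app ρ σ {h} {x}
  ; Π∈        = λ ρ σ → C≤-Π (arith ρ) (arith σ)
  ; Σ∈        = λ ρ σ τ → C≤-Σ (arith ρ) (arith σ) (arith τ)
  ; 0∈        = C≤-nat 0
  ; S∈        = C≤-nat⇒ nat {Sᶜ} (λ n → C≤-nat (suc n))
  ; R∈        = λ σ → C≤-R (arith σ)
  -- The set-theoretic constants compute, so both sides of each defining equation are the same by
  -- evaluation.
  ; Π-axiom   = λ ρ σ x y _ _ → Setoid.refl ⟦ ρ ⟧ᵃ
  ; Σ-axiom   = λ ρ σ τ x y z _ _ _ → Setoid.refl ⟦ τ ⟧ᵃ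
  ; R-zero    = λ σ w f _ _ → Setoid.refl ⟦ σ ⟧ᵃ
  ; R-suc     = λ σ n w f _ _ _ → Setoid.refl ⟦ σ ⟧ᵃ
  ; S≉0       = λ n _ ()
  ; S-inj     = λ m n _ _ → suc-injective
  ; induction = λ P P0 PS n _ → ind P P0 PS n
  }
  where
  ind : ∀ (P : ℕ → Set) → P 0 → (∀ n → C≤ nat n → P n → P (suc n)) → ∀ n → P n
  ind P P0 PS zero    = P0
  ind P P0 PS (suc n) = PS n (C≤-nat n) (ind P P0 PS n)
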